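{- For every integer $n>0$, the rook equivalence graph $G(B)$ of the Ferrers board $B=(0,1,2,\ldots,n-1,n-1)$ (with $n+1$ columns of heights $0,1,\ldots,n-1$ followed by $n-1$) is isomorphic to the complete graph $K_n$.
   Context: A Ferrers board is given by a weakly increasing sequence of non-negative integers $B=(b_1,\ldots,b_n)$ of column heights; it is the set of unit cells in the first quadrant lying in column $i$ and rows $1,\ldots,b_i$. Prepending columns of height $0$ on the left does not change the board, and boards are compared using the same number of columns by such padding. A placement of $k$ rooks on $B$ is a set of $k$ cells of $B$ no two in the same row or column; $r_k(B)$ is the number of such placements. Two boards are rook equivalent if they have equal $r_k$ for all $k\ge 0$. The rook equivalence graph $G(B)$ has as vertices all Ferrers boards rook equivalent to $B$, and $\{B_1,B_2\}$ is an edge iff, written with the same number of columns, $B_1$ and $B_2$ differ in exactly two columns $i$ and $j$, where $B_1$ has $k$ more cells than $B_2$ in column $i$ and $k$ fewer cells than $B_2$ in column $j$, for some $k>0$. -}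

module Defs where

open import Data.Fin using (Fin; zero; suc)
open import Data.List.Base
  using (List; []; _∷_; [_]; _++_; map; concat; filter; length; zipWith; upTo; applyUpTo; replicate)
open import Data.List.Properties using (length-++; length-replicate; ++-cancelˡ)
open import Data.List.Relation.Unary.All using ([]; _∷_)
open import Data.List.Relation.Unary.All.Properties as All using ()
open import Data.List.Relation.Unary.AllPairs using ([]; _∷_; allPairs?)
open import Data.List.Relation.Unary.AllPairs.Properties as AllPairs using ()
open import Data.List.Relation.Unary.Sorted.TotalOrder using (Sorted)
open import Data.List.Relation.Unary.Sorted.TotalOrder.Properties using (AllPairs⇒Sorted)
open import Data.Nat using (ℕ; zero; suc; pred; _+_; _<_; _≟_)
open import Data.Nat.Properties
  using (≤-totalOrder; <⇒≤; <⇒≤pred; +-comm; +-cancelʳ-≡; +-identityʳ; m<m+n; <-irrefl)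
open import Data.Product using (Σ; ∃; ∃₂; _×_; _,_; proj₁; proj₂)
open import Data.Vec as Vec using (Vec; lookup; toList)
open import Data.Vec.Properties as Vec using (length-toList)
open import Function.Base using (id; _∘_)
open import Function.Bundles using (Inverse; _⇔_)
open import Level using (0ℓ)
open import Relation.Binary.Bundles using (Setoid)
open import Relation.Binary.Construct.On as On using ()
open import Relation.Binary.Definitions using (Symmetric; Irreflexive; _Respects₂_; Decidable)
open import Relation.Binary.PropositionalEquality
  using (_≡_; _≢_; refl; sym; trans; cong; subst; setoid; module ≡-Reasoning)
open import Relation.Nullary using (¬_)
open import Relation.Nullary.Decidable using (_×-dec_; ¬?)

record Graph : Set₁ where
  field
    vertices    : Setoid 0ℓ 0ℓ
  open Setoid vertices public using (_≈_) renaming (Carrier to Vertex)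
  field
    Edge        : Vertex → Vertex → Set
    edge-resp   : Edge Respects₂ _≈_
    edge-sym    : Symmetric Edge
    edge-irrefl : Irreflexive _≈_ Edge

infix 4 _≅_

record _≅_ (G H : Graph) : Set where
  private
    module G = Graph G
    module H = Graph H
  field
    bijection : Inverse G.vertices H.vertices
  open Inverse bijection public using (to; from)
  field
    edges     : ∀ x y → G.Edge x y ⇔ H.Edge (to x) (to y)

K : ℕ → Graph
K n = record
  { vertices    = setoid (Fin n)
  ; Edge        = _≢_
  ; edge-resp   = (λ { refl → id }) , (λ { refl → id })
  ; edge-sym    = _∘ sym
  ; edge-irrefl = λ x≡y x≢y → x≢y x≡y
  }

record Board : Set where
  constructor board
  field
    heights    : List ℕ
    increasing : Sorted ≤-totalOrder heights

open Board public

pad : ℕ → List ℕ → List ℕ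
pad m hs = replicate m 0 ++ hs

-- Columns of height 0 on the left do not change a board, so two height
-- sequences describe the same board when some paddings of them coincide.
infix 4 _≈ᴮ_

_≈ᴮ_ : Board → Board → Set
B ≈ᴮ C = ∃₂ λ m n → pad m (heights B) ≡ pad n (heights C)

Cell : Set
Cell = ℕ × ℕ

column : ℕ → ℕ → List Cell
column i b = map (i ,_) (applyUpTo suc b)

cells : Board → List Cell
cells B = concat (zipWith column (applyUpTo suc (length (heights B))) (heights B))

NonAttacking : Cell → Cell → Set
NonAttacking (i , j) (i′ , j′) = i ≢ i′ × j ≢ j′

nonAttacking? : Decidable NonAttacking
nonAttacking? (i , j) (i′ , j′) = ¬? (i ≟ i′) ×-dec ¬? (j ≟ j′)

-- The sublists of length k; as the list of cells of a board has no
-- repetitions, these represent each k-element set of cells exactly once.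
choose : ∀ {A : Set} → ℕ → List A → List (List A)
choose zero    xs       = [ [] ]
choose (suc k) []       = []
choose (suc k) (x ∷ xs) = map (x ∷_) (choose k xs) ++ choose (suc k) xs

placements : ℕ → Board → List (List Cell)
placements k B = filter (allPairs? nonAttacking?) (choose k (cells B))

r : ℕ → Board → ℕ
r k B = length (placements k B)

RookEquivalent : Board → Board → Set
RookEquivalent B C = ∀ k → r k B ≡ r k C

-- u is the height sequence of B written with N columns.
Writes : ∀ {N} → Vec ℕ N → Board → Set
Writes u B = ∃ λ m → toList u ≡ pad m (heights B)

record DifferInTwoColumns {N} (u v : Vec ℕ N) : Set where
  constructor differ
  field
    i j   : Fin N
    k     : ℕ
    k>0   : 0 < k
    more  : lookup u i ≡ lookup v i + k
    fewer : lookup u j + k ≡ lookup v j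
    other : ∀ l → l ≢ i → l ≢ j → lookup u l ≡ lookup v l

Adjacent : Board → Board → Set
Adjacent B C = ∃ λ N → ∃₂ λ (u v : Vec ℕ N) →
  Writes u B × Writes v C × DifferInTwoColumns u v

pad-+ : ∀ m n hs → pad (m + n) hs ≡ pad m (pad n hs)
pad-+ zero    n hs = refl
pad-+ (suc m) n hs = cong (0 ∷_) (pad-+ m n hs)

pad-comm : ∀ m n hs → pad m (pad n hs) ≡ pad n (pad m hs)
pad-comm m n hs = begin
  pad m (pad n hs) ≡⟨ pad-+ m n hs ⟨
  pad (m + n) hs   ≡⟨ cong (λ p → pad p hs) (+-comm m n) ⟩
  pad (n + m) hs   ≡⟨ pad-+ n m hs ⟩
  pad n (pad m hs) ∎
  where open ≡-Reasoning

length-pad : ∀ m hs → length (pad m hs) ≡ m + length hs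
length-pad m hs = trans (length-++ (replicate m 0)) (cong (_+ length hs) (length-replicate m))

pad-chain : ∀ {m n p q} xs ys zs → pad m xs ≡ pad n ys → pad p ys ≡ pad q zs →
            pad (p + m) xs ≡ pad (n + q) zs
pad-chain {m} {n} {p} {q} xs ys zs e f = begin
  pad (p + m) xs   ≡⟨ pad-+ p m xs ⟩
  pad p (pad m xs) ≡⟨ cong (pad p) e ⟩
  pad p (pad n ys) ≡⟨ pad-comm p n ys ⟩
  pad n (pad p ys) ≡⟨ cong (pad n) f ⟩
  pad n (pad q zs) ≡⟨ pad-+ n q zs ⟨
  pad (n + q) zs   ∎
  where open ≡-Reasoning

pad-injective : ∀ m n xs ys → length xs ≡ length ys → pad m xs ≡ pad n ys → xs ≡ ys
pad-injective m n xs ys l e with m≡n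
  where
  m≡n : m ≡ n
  m≡n = +-cancelʳ-≡ (length xs) m n (trans (sym (length-pad m xs))
          (trans (cong length e) (trans (length-pad n ys) (cong (n +_) (sym l)))))
... | refl = ++-cancelˡ (replicate m 0) xs ys e

boardSetoid : Setoid 0ℓ 0ℓ
boardSetoid = record
  { Carrier       = Board
  ; _≈_           = _≈ᴮ_
  ; isEquivalence = record
    { refl  = 0 , 0 , refl
    ; sym   = λ (m , n , e) → n , m , sym e
    ; trans = λ {B} {C} {D} (m , n , e) (p , q , f) →
        p + m , n + q , pad-chain (heights B) (heights C) (heights D) e f
    }
  }

padVec : ∀ {N} m → Vec ℕ N → Vec ℕ (m + N)
padVec m u = Vec.replicate m 0 Vec.++ u

toList-padVec : ∀ {N} m (u : Vec ℕ N) → toList (padVec m u) ≡ pad m (toList u)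
toList-padVec zero    u = refl
toList-padVec (suc m) u = cong (0 ∷_) (toList-padVec m u)

differ-pad : ∀ {N} m {u v : Vec ℕ N} → DifferInTwoColumns u v →
             DifferInTwoColumns (padVec m u) (padVec m v)
differ-pad zero    d = d
differ-pad (suc m) d with differ-pad m d
... | differ i j k k>0 more fewer other = differ (suc i) (suc j) k k>0 more fewer λ where
  zero    _   _   → refl
  (suc l) l≢i l≢j → other l (l≢i ∘ cong suc) (l≢j ∘ cong suc)

differ-sym : ∀ {N} {u v : Vec ℕ N} → DifferInTwoColumns u v → DifferInTwoColumns v u
differ-sym (differ i j k k>0 more fewer other) =
  differ j i k k>0 (sym fewer) (sym more) (λ l l≢j l≢i → sym (other l l≢i l≢j))

differ-irrefl : ∀ {N} (u : Vec ℕ N) → ¬ DifferInTwoColumns u u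
differ-irrefl u (differ i j k k>0 more fewer other) = <-irrefl more (m<m+n (lookup u i) k>0)

adjacent-sym : Symmetric Adjacent
adjacent-sym (N , u , v , wu , wv , d) = N , v , u , wv , wu , differ-sym d

adjacent-respʳ : ∀ {B C C′} → C ≈ᴮ C′ → Adjacent B C → Adjacent B C′
adjacent-respʳ {B} {C} {C′} (p , q , e) (N , u , v , (m , wu) , (n , wv) , d) =
  p + N , padVec p u , padVec p v ,
  (p + m , trans (toList-padVec p u) (trans (cong (pad p) wu) (sym (pad-+ p m (heights B))))) ,
  (n + q , (begin
    toList (padVec p v)      ≡⟨ toList-padVec p v ⟩
    pad p (toList v)         ≡⟨ cong (λ p′ → pad p′ (toList v)) (+-identityʳ p) ⟨
    pad (p + 0) (toList v)   ≡⟨ pad-chain (toList v) (heights C) (heights C′) wv e ⟩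
    pad (n + q) (heights C′) ∎)) ,
  differ-pad p d
  where open ≡-Reasoning

adjacent-irrefl : Irreflexive _≈ᴮ_ Adjacent
adjacent-irrefl {B} {C} (p , q , e) (N , u , v , (m , wu) , (n , wv) , d) =
  differ-irrefl v (subst (λ w → DifferInTwoColumns w v) u≡v d)
  where
  lists≡ : toList u ≡ toList v
  lists≡ = pad-injective (n + (p + 0)) ((m + q) + 0) (toList u) (toList v)
    (trans (length-toList u) (sym (length-toList v)))
    (pad-chain (toList u) (heights C) (toList v)
      (pad-chain (toList u) (heights B) (heights C) wu e) (sym wv))
  u≡v : u ≡ v
  u≡v = trans (sym (Vec.cast-is-id refl u)) (Vec.toList-injective refl u v lists≡)

G : Board → Graph
G B = record
  { vertices    = On.setoid {B = Σ Board (RookEquivalent B)} boardSetoid proj₁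
  ; Edge        = λ (C , _) (D , _) → Adjacent C D
  ; edge-resp   = (λ {(A , _)} {(C , _)} {(D , _)} → adjacent-respʳ {A} {C} {D})
                , (λ {(A , _)} {(C , _)} {(D , _)} e →
                     adjacent-sym {A} {D} ∘ adjacent-respʳ {A} {C} {D} e ∘ adjacent-sym {C} {A})
  ; edge-sym    = λ {(C , _)} {(D , _)} → adjacent-sym {C} {D}
  ; edge-irrefl = λ {(C , _)} {(D , _)} → adjacent-irrefl {C} {D}
  }

-- The heights 0, 1, …, n-1, n-1; intended for n > 0.
staircase : ℕ → Board
staircase n = board (upTo n ++ [ pred n ]) (AllPairs⇒Sorted ≤-totalOrder
  (AllPairs.++⁺
    (AllPairs.applyUpTo⁺₁ id n (λ i<j _ → <⇒≤ i<j))
    ([] ∷ [])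
    (All.applyUpTo⁺₁ id n (λ i<n → <⇒≤pred i<n ∷ []))))

{-# OPTIONS --safe #-}
module Submission where

-- By the factorization theorem of Goldman, Joichi and White, the rook numbers of a board with
-- heights b_0 ≤ b_1 ≤ … determine, and are determined by, the polynomial ∏ (x + b_i − i). For
-- (0, 1, …, n-1, n-1) it is xⁿ (x − 1), so an equivalent board with n + 1 columns has all
-- b_i ∈ {i, i − 1}, and the value r_1 (the number of cells) leaves exactly one i, with i > 0, where
-- b_i = i − 1. These n boards are pairwise adjacent. An equivalent board with more columns starts
-- with a column of height 0, as a height b_0 > 0 would yield the negative root −b_0.

open import Defs
import Algebra.Properties.AbelianGroup as AbelianGroup
open import Data.Bool.Base using (true; false)
open import Data.Fin using (Fin; zero; suc; toℕ; fromℕ)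
import Data.Fin.Properties as Fin
open import Data.Integer using (ℤ; +_; 0ℤ; 1ℤ)
import Data.Integer as ℤ
import Data.Integer.Properties as ℤ
import Data.Integer.Tactic.RingSolver as ℤ-Solver
open import Data.List.Base
  using (List; []; _∷_; [_]; _++_; map; concat; concatMap; filter; length; zipWith; applyUpTo)
open import Data.List.Membership.Propositional using (_∈_)
open import Data.List.Membership.Propositional.Properties using (∈-applyUpTo⁺; ∈-applyUpTo⁻)
open import Data.List.Properties
  using (filter-++; filter-all; filter-none; filter-accept; filter-reject; length-++; length-map;
         length-applyUpTo; map-∘; map-cong-local)
open import Data.List.Relation.Binary.Subset.Propositional using (_⊆_)
open import Data.List.Relation.Binary.Subset.Propositional.Properties using (filter⁺′)
open import Data.List.Relation.Unary.All as All using (All; []; _∷_; all?)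
import Data.List.Relation.Unary.All.Properties as All
open import Data.List.Relation.Unary.AllPairs as AllPairs using (AllPairs; []; _∷_; allPairs?)
import Data.List.Relation.Unary.AllPairs.Properties as AllPairs
open import Data.List.Relation.Unary.Any using (here; there)
open import Data.List.Relation.Unary.Linked using ([-]; _∷_)
open import Data.List.Relation.Unary.Sorted.TotalOrder using (Sorted)
open import Data.List.Relation.Unary.Sorted.TotalOrder.Properties using (Sorted⇒AllPairs)
open import Data.List.Relation.Unary.Unique.Propositional using (Unique)
import Data.List.Relation.Unary.Unique.Propositional.Properties as Unique
open import Data.Nat using (ℕ; zero; suc; pred; _+_; _*_; _<_; _≤_; _≟_; s≤s; z≤n; z<s)
open import Data.Nat.ListAction using (sum)
open import Data.Nat.Properties
  using (+-assoc; +-comm; +-suc; +-identityʳ; +-cancelˡ-≡; +-mono-≤; +-monoʳ-≤; *-identityʳ; *-zeroʳ;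
         suc-injective; pred-mono-≤; ≤-refl; ≤-reflexive; <-≤-trans; ≤-<-connex; <⇒≢; 0≢1+n; n≤1+n;
         m≤n+m; m≤n⇒m≤1+n; m<n⇒m<1+n; m≤n⇒m<n∨m≡n; ≤-totalOrder)
open import Data.Product using (∃; _×_; _,_; proj₁; proj₂; map₂)
open import Data.Sum using (_⊎_; inj₁; inj₂)
open import Data.Vec using (Vec; []; _∷_; lookup; toList)
open import Data.Vec.Properties using (length-toList)
open import Function.Base using (id; _∘_)
open import Function.Bundles using (mk⇔)
open import Level using (0ℓ)
open import Relation.Binary.Bundles using (Setoid)
open import Relation.Binary.Core using (Rel)
open import Relation.Binary.Definitions using (Decidable)
open import Relation.Binary.PropositionalEquality
  using (_≡_; _≢_; refl; sym; trans; cong; cong₂; subst; module ≡-Reasoning)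
import Relation.Binary.Reasoning.Setoid as ≈-Reasoning
open import Relation.Nullary using (yes; no; does; contradiction)
open import Relation.Nullary.Decidable using (¬?; decidable-stable)
import Relation.Unary as U

open AbelianGroup ℤ.+-0-abelianGroup using (∙-cancelʳ)

-- Counting cliques by their first element

filter-all-map-∷ : ∀ {A : Set} {P : A → Set} (P? : U.Decidable P) x yss →
                   filter (all? P?) (map (x ∷_) yss) ≡
                   filter (λ _ → P? x) (map (x ∷_) (filter (all? P?) yss))
filter-all-map-∷ P? x [] = refl
filter-all-map-∷ P? x (ys ∷ yss) with does (P? x) in px | does (all? P? ys)
... | true  | true  rewrite px = cong ((x ∷ ys) ∷_) (filter-all-map-∷ P? x yss)
... | true  | false = filter-all-map-∷ P? x yss
... | false | true  rewrite px = filter-all-map-∷ P? x yss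
... | false | false = filter-all-map-∷ P? x yss

-- For the sublists that start with `x`, `filter-all-map-∷` leaves an outer filter that ignores its
-- argument, so one case split on `P? x` keeps or drops them all.
choose-filter : ∀ {A : Set} {P : A → Set} (P? : U.Decidable P) k xs →
                filter (all? P?) (choose k xs) ≡ choose k (filter P? xs)
choose-filter P? zero    xs = refl
choose-filter P? (suc k) [] = refl
choose-filter P? (suc k) (x ∷ xs)
  rewrite filter-++ (all? P?) (map (x ∷_) (choose k xs)) (choose (suc k) xs)
        | filter-all-map-∷ P? x (choose k xs)
        | choose-filter P? k xs | choose-filter P? (suc k) xs
  with P? x
... | yes px = cong (_++ choose (suc k) (filter P? xs))
                    (filter-all (λ _ → yes px) (All.universal (λ _ → px) _))
... | no ¬px = cong (_++ choose (suc k) (filter P? xs))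
                    (filter-none (λ _ → no ¬px)
                      (All.universal (λ _ → ¬px) (map (x ∷_) (choose k (filter P? xs)))))

module _ {A : Set} {R : Rel A 0ℓ} (R? : Decidable R) where

  -- For `nonAttacking?` and the cells of a board this unfolds to the rook number `r`.
  cliques : ℕ → List A → ℕ
  cliques k xs = length (filter (allPairs? R?) (choose k xs))

  length-filter-allPairs-∷ : ∀ x yss →
    length (filter (allPairs? R?) (map (x ∷_) yss)) ≡
    length (filter (allPairs? R?) (filter (all? (R? x)) yss))
  length-filter-allPairs-∷ x [] = refl
  length-filter-allPairs-∷ x (ys ∷ yss) with does (all? (R? x) ys)
  ... | false = length-filter-allPairs-∷ x yss
  ... | true with does (allPairs? R? ys)
  ...   | true  = cong suc (length-filter-allPairs-∷ x yss)
  ...   | false = length-filter-allPairs-∷ x yss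

  -- Split by whether `x` is chosen. If it is, the other `k` elements must all be related to `x`,
  -- and by `choose-filter` they may as well be chosen from the filtered list.
  cliques-∷ : ∀ k x xs → cliques (suc k) (x ∷ xs) ≡ cliques k (filter (R? x) xs) + cliques (suc k) xs
  cliques-∷ k x xs = begin
    length (filter (allPairs? R?) (map (x ∷_) (choose k xs) ++ choose (suc k) xs))
      ≡⟨ cong length (filter-++ (allPairs? R?) (map (x ∷_) (choose k xs)) _) ⟩
    length (filter (allPairs? R?) (map (x ∷_) (choose k xs)) ++ filter (allPairs? R?) (choose (suc k) xs))
      ≡⟨ length-++ (filter (allPairs? R?) (map (x ∷_) (choose k xs))) ⟩
    length (filter (allPairs? R?) (map (x ∷_) (choose k xs))) + cliques (suc k) xs
      ≡⟨ cong (_+ cliques (suc k) xs) (length-filter-allPairs-∷ x (choose k xs)) ⟩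
    length (filter (allPairs? R?) (filter (all? (R? x)) (choose k xs))) + cliques (suc k) xs
      ≡⟨ cong (λ yss → length (filter (allPairs? R?) yss) + cliques (suc k) xs) (choose-filter (R? x) k xs) ⟩
    cliques k (filter (R? x) xs) + cliques (suc k) xs
      ∎
    where open ≡-Reasoning

-- Rook numbers by expansion along the leftmost column

length-filter-≢ : ∀ {j js} → Unique js → j ∈ js → length (filter (λ r → ¬? (j ≟ r)) js) ≡ pred (length js)
length-filter-≢ {j} (j∉js ∷ _) (here refl) =
  cong length (trans (filter-reject (λ r → ¬? (j ≟ r)) (λ j≢j → j≢j refl)) (filter-all (λ r → ¬? (j ≟ r)) j∉js))
length-filter-≢ {j} {i ∷ js} (i∉js ∷ js!) (there j∈js) =
  trans (cong length (filter-accept (λ r → ¬? (j ≟ r)) (All.lookup i∉js j∈js ∘ sym)))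
        (trans (cong suc (length-filter-≢ js! j∈js)) (suc-pred-length j∈js))
  where
  suc-pred-length : ∀ {j : ℕ} {js} → j ∈ js → suc (pred (length js)) ≡ length js
  suc-pred-length (here _)  = refl
  suc-pred-length (there _) = refl

-- The leftmost column is the lowest, so a rook in any of its `h` rows removes one row from every
-- later column; this is the `pred`. Truncation does no harm for increasing heights: a later height
-- 0 forces `h` to be 0, and the product vanishes.
rooks : ℕ → List ℕ → ℕ
rooks zero    hs       = 1
rooks (suc k) []       = 0
rooks (suc k) (h ∷ hs) = h * rooks k (map pred hs) + rooks (suc k) hs

-- A column index together with the rows of the column that are not yet attacked.
Column : Set
Column = ℕ × List ℕ

columnCells : Column → List Cell
columnCells (i , js) = map (i ,_) js

-- Deleting a row destroys the shape of an initial segment, but inclusion between columns survives,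
-- which makes it the invariant for the induction.
Nested : Column → Column → Set
Nested (i , js) (i′ , js′) = i ≢ i′ × js ⊆ js′

deleteRow : ℕ → Column → Column
deleteRow j = map₂ (filter (λ r → ¬? (j ≟ r)))

filter-sameColumn : ∀ i j js cs →
  filter (nonAttacking? (i , j)) (map (i ,_) js ++ cs) ≡ filter (nonAttacking? (i , j)) cs
filter-sameColumn i j []       cs = refl
filter-sameColumn i j (r ∷ js) cs =
  trans (filter-reject (nonAttacking? (i , j)) (λ (i≢i , _) → i≢i refl)) (filter-sameColumn i j js cs)

filter-otherColumn : ∀ {i i′} j js → i ≢ i′ →
  filter (nonAttacking? (i , j)) (map (i′ ,_) js) ≡ map (i′ ,_) (filter (λ r → ¬? (j ≟ r)) js)
filter-otherColumn j [] i≢i′ = refl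
filter-otherColumn {i} {i′} j (r ∷ js) i≢i′ with j ≟ r
... | no j≢r = trans (filter-accept (nonAttacking? (i , j)) (i≢i′ , j≢r))
    (trans (cong ((i′ , r) ∷_) (filter-otherColumn j js i≢i′))
           (cong (map (i′ ,_)) (sym (filter-accept (λ r → ¬? (j ≟ r)) j≢r))))
... | yes j≡r = trans (filter-reject (nonAttacking? (i , j)) (λ (_ , j≢r) → j≢r j≡r))
    (trans (filter-otherColumn j js i≢i′)
           (cong (map (i′ ,_)) (sym (filter-reject (λ r → ¬? (j ≟ r)) (λ j≢r → j≢r j≡r)))))

filter-columns : ∀ {i} j cols → All (λ c → i ≢ proj₁ c) cols →
  filter (nonAttacking? (i , j)) (concatMap columnCells cols) ≡ concatMap columnCells (map (deleteRow j) cols)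
filter-columns j [] [] = refl
filter-columns {i} j ((i′ , js) ∷ cols) (i≢i′ ∷ i≢) =
  trans (filter-++ (nonAttacking? (i , j)) (map (i′ ,_) js) _)
        (cong₂ _++_ (filter-otherColumn j js i≢i′) (filter-columns j cols i≢))

-- A rook in column `i` attacks the rest of its column, so the other rooks stand in `cs`. Which
-- cells of `cs` remain depends on the row `j`; the hypothesis asks only that their count `v` does
-- not.
cliques-column : ∀ k i js cs {v} →
  (∀ {j} → j ∈ js → cliques nonAttacking? k (filter (nonAttacking? (i , j)) cs) ≡ v) →
  cliques nonAttacking? (suc k) (map (i ,_) js ++ cs) ≡ length js * v + cliques nonAttacking? (suc k) cs
cliques-column k i []       cs eq = refl
cliques-column k i (j ∷ js) cs {v} eq = begin
  cliques nonAttacking? (suc k) ((i , j) ∷ map (i ,_) js ++ cs)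
    ≡⟨ cliques-∷ nonAttacking? k (i , j) (map (i ,_) js ++ cs) ⟩
  cliques nonAttacking? k (filter (nonAttacking? (i , j)) (map (i ,_) js ++ cs))
    + cliques nonAttacking? (suc k) (map (i ,_) js ++ cs)
    ≡⟨ cong₂ _+_ (trans (cong (cliques nonAttacking? k) (filter-sameColumn i j js cs)) (eq (here refl)))
                 (cliques-column k i js cs (eq ∘ there)) ⟩
  v + (length js * v + cliques nonAttacking? (suc k) cs)
    ≡⟨ +-assoc v (length js * v) _ ⟨
  v + length js * v + cliques nonAttacking? (suc k) cs
    ∎
  where open ≡-Reasoning

-- By nesting, the row `j` of a rook in the first column occurs in all other columns, and by
-- uniqueness each of them loses exactly one row. Both invariants survive the deletion, so induction
-- on `k` applies.
cliques-columns : ∀ k cols → AllPairs Nested cols → All (Unique ∘ proj₂) cols →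
  cliques nonAttacking? k (concatMap columnCells cols) ≡ rooks k (map (length ∘ proj₂) cols)
cliques-columns zero    cols nested unique = refl
cliques-columns (suc k) []   nested unique = refl
cliques-columns (suc k) ((i , js) ∷ cols) (below ∷ nested) (js! ∷ unique) =
  trans (cliques-column k i js (concatMap columnCells cols) afterRook)
        (cong (_+_ (length js * rooks k (map pred (map (length ∘ proj₂) cols))))
              (cliques-columns (suc k) cols nested unique))
  where
  open ≡-Reasoning
  afterRook : ∀ {j} → j ∈ js →
    cliques nonAttacking? k (filter (nonAttacking? (i , j)) (concatMap columnCells cols))
      ≡ rooks k (map pred (map (length ∘ proj₂) cols))
  afterRook {j} j∈js = begin
    cliques nonAttacking? k (filter (nonAttacking? (i , j)) (concatMap columnCells cols))
      ≡⟨ cong (cliques nonAttacking? k) (filter-columns j cols (All.map proj₁ below)) ⟩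
    cliques nonAttacking? k (concatMap columnCells (map (deleteRow j) cols))
      ≡⟨ cliques-columns k (map (deleteRow j) cols)
           (AllPairs.map⁺ (AllPairs.map (λ (i≢ , js⊆) →
             i≢ , λ {_} → filter⁺′ (λ r → ¬? (j ≟ r)) (λ r → ¬? (j ≟ r)) id js⊆) nested))
           (All.map⁺ (All.map (Unique.filter⁺ (λ r → ¬? (j ≟ r))) unique)) ⟩
    rooks k (map (length ∘ proj₂) (map (deleteRow j) cols))
      ≡⟨ cong (rooks k) (trans (sym (map-∘ cols))
           (trans (map-cong-local (All.zipWith shorter (below , unique))) (map-∘ cols))) ⟩
    rooks k (map pred (map (length ∘ proj₂) cols))
      ∎
    where
    shorter : ∀ {c} → Nested (i , js) c × Unique (proj₂ c) →
              length (proj₂ (deleteRow j c)) ≡ pred (length (proj₂ c))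
    shorter ((_ , js⊆) , js′!) = length-filter-≢ js′! (js⊆ j∈js)

-- The index function is shifted at every step to match the recursion of `applyUpTo` in `cells`.
columns : (ℕ → ℕ) → List ℕ → List Column
columns f []       = []
columns f (h ∷ hs) = (f 0 , applyUpTo suc h) ∷ columns (f ∘ suc) hs

concat-columns : ∀ f hs →
  concat (zipWith column (applyUpTo f (length hs)) hs) ≡ concatMap columnCells (columns f hs)
concat-columns f []       = refl
concat-columns f (h ∷ hs) = cong (column (f 0) h ++_) (concat-columns (f ∘ suc) hs)

columns-nested : ∀ f hs →
  (∀ {i j} → f i ≡ f j → i ≡ j) → AllPairs _≤_ hs → AllPairs Nested (columns f hs)
columns-nested f []       inj []         = []
columns-nested f (h ∷ hs) inj (h≤ ∷ hs↗) =
  below (f ∘ suc) hs (λ eq → 0≢1+n (inj eq)) h≤ ∷ columns-nested (f ∘ suc) hs (suc-injective ∘ inj) hs↗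
  where
  below : ∀ g hs → (∀ {j} → f 0 ≢ g j) → All (h ≤_) hs →
          All (Nested (f 0 , applyUpTo suc h)) (columns g hs)
  below g [] f≢g [] = []
  below g (h′ ∷ hs) f≢g (h≤h′ ∷ h≤) = (f≢g , higher) ∷ below (g ∘ suc) hs f≢g h≤
    where
    higher : applyUpTo suc h ⊆ applyUpTo suc h′
    higher r∈ with ∈-applyUpTo⁻ suc r∈
    ... | j , j<h , refl = ∈-applyUpTo⁺ suc (<-≤-trans j<h h≤h′)

columns-unique : ∀ f hs → All (Unique ∘ proj₂) (columns f hs)
columns-unique f []       = []
columns-unique f (h ∷ hs) =
  Unique.applyUpTo⁺₁ suc h (λ i<j _ → <⇒≢ i<j ∘ suc-injective) ∷ columns-unique (f ∘ suc) hs

lengths-columns : ∀ f hs → map (length ∘ proj₂) (columns f hs) ≡ hs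
lengths-columns f []       = refl
lengths-columns f (h ∷ hs) = cong₂ _∷_ (length-applyUpTo suc h) (lengths-columns (f ∘ suc) hs)

r≡rooks : ∀ k B → r k B ≡ rooks k (heights B)
r≡rooks k B = begin
  cliques nonAttacking? k (cells B)
    ≡⟨ cong (cliques nonAttacking? k) (concat-columns suc hs) ⟩
  cliques nonAttacking? k (concatMap columnCells (columns suc hs))
    ≡⟨ cliques-columns k (columns suc hs)
         (columns-nested suc hs suc-injective (Sorted⇒AllPairs ≤-totalOrder (increasing B)))
         (columns-unique suc hs) ⟩
  rooks k (map (length ∘ proj₂) (columns suc hs))
    ≡⟨ cong (rooks k) (lengths-columns suc hs) ⟩
  rooks k hs ∎
  where
  open ≡-Reasoning
  hs = heights B

-- The factorization theorem

Increasing : List ℕ → Set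
Increasing = Sorted ≤-totalOrder

rooks-vanish : ∀ k hs → length hs < k → rooks k hs ≡ 0
rooks-vanish (suc k) []       _ = refl
rooks-vanish (suc k) (h ∷ hs) (s≤s l<k) = begin
  h * rooks k (map pred hs) + rooks (suc k) hs
    ≡⟨ cong₂ (λ a b → h * a + b) (rooks-vanish k (map pred hs) (subst (_< k) (sym (length-map pred hs)) l<k))
                                 (rooks-vanish (suc k) hs (m<n⇒m<1+n l<k)) ⟩
  h * 0 + 0 ≡⟨ cong (_+ 0) (*-zeroʳ h) ⟩
  0 ∎
  where open ≡-Reasoning

-- Horner's scheme for Σ f k · x (x-1) ⋯ (x-N+k+1) over k ≤ N.
falling : (ℕ → ℕ) → ℕ → ℤ → ℤ
falling f zero    x = + f 0
falling f (suc N) x = x ℤ.* falling f N (x ℤ.- 1ℤ) ℤ.+ + f (suc N)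

falling-cong : ∀ {f g} → (∀ k → f k ≡ g k) → ∀ N x → falling f N x ≡ falling g N x
falling-cong f≗g zero    x = cong +_ (f≗g 0)
falling-cong f≗g (suc N) x =
  cong₂ (λ a b → x ℤ.* a ℤ.+ + b) (falling-cong f≗g N (x ℤ.- 1ℤ)) (f≗g (suc N))

-- At 0 only the last coefficient survives. At `suc y`, cancelling that coefficient and then the
-- nonzero factor `suc y` leaves the identity of order `N` at `y`.
falling-injective : ∀ f g N → (∀ x → falling f N (+ x) ≡ falling g N (+ x)) → ∀ k → k ≤ N → f k ≡ g k
falling-injective f g zero    eq zero k≤N = ℤ.+-injective (eq 0)
falling-injective f g (suc N) eq k k≤N with m≤n⇒m<n∨m≡n k≤N
... | inj₂ refl       = ℤ.+-injective (eq 0)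
... | inj₁ (s≤s k≤N′) = falling-injective f g N lower k k≤N′
  where
  lower : ∀ y → falling f N (+ y) ≡ falling g N (+ y)
  lower y = ℤ.*-cancelˡ-≡ (+ suc y) _ _ (∙-cancelʳ (+ g (suc N)) _ _
    (trans (cong (λ t → + suc y ℤ.* falling f N (+ y) ℤ.+ t) (sym (eq 0))) (eq (suc y))))

-- Carries the recursion of `rooks` over to polynomials: the term of index `k + 1` at order `N + 1`
-- has the same falling factors as the term of index `k` at order `N`.
falling-∷ : ∀ h f g e → e 0 ≡ g 0 → (∀ k → e (suc k) ≡ h * f k + g (suc k)) →
            ∀ N x → falling e (suc N) x ≡ + h ℤ.* falling f N x ℤ.+ falling g (suc N) x
falling-∷ h f g e e0 e+ = go
  where
  e+ᶻ : ∀ k → + e (suc k) ≡ + h ℤ.* + f k ℤ.+ + g (suc k)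
  e+ᶻ k = trans (cong +_ (e+ k)) (trans (ℤ.pos-+ (h * f k) _) (cong (ℤ._+ + g (suc k)) (ℤ.pos-* h (f k))))
  regroup₀ : ∀ x g₀ h f₀ g₁ → x ℤ.* g₀ ℤ.+ (h ℤ.* f₀ ℤ.+ g₁) ≡ h ℤ.* f₀ ℤ.+ (x ℤ.* g₀ ℤ.+ g₁)
  regroup₀ = ℤ-Solver.solve-∀
  regroup : ∀ x h p q f′ g′ →
            x ℤ.* (h ℤ.* p ℤ.+ q) ℤ.+ (h ℤ.* f′ ℤ.+ g′)
            ≡ h ℤ.* (x ℤ.* p ℤ.+ f′) ℤ.+ (x ℤ.* q ℤ.+ g′)
  regroup = ℤ-Solver.solve-∀
  go : ∀ N x → falling e (suc N) x ≡ + h ℤ.* falling f N x ℤ.+ falling g (suc N) x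
  go zero    x = trans (cong₂ (λ a b → x ℤ.* + a ℤ.+ b) e0 (e+ᶻ 0)) (regroup₀ x (+ g 0) (+ h) (+ f 0) (+ g 1))
  go (suc N) x = trans (cong₂ (λ a b → x ℤ.* a ℤ.+ b) (go N (x ℤ.- 1ℤ)) (e+ᶻ (suc N)))
    (regroup x (+ h) (falling f N (x ℤ.- 1ℤ)) (falling g (suc N) (x ℤ.- 1ℤ)) (+ f (suc N)) (+ g (suc (suc N))))

-- The product of x + b_i − i over the columns i = 0, 1, ….
factorial : ℤ → List ℕ → ℤ
factorial x []       = 1ℤ
factorial x (h ∷ hs) = (x ℤ.+ + h) ℤ.* factorial (x ℤ.- 1ℤ) hs

-- Lowering every height by 1 or lowering `x` by 1 has the same effect on each factor; positivity
-- keeps `pred` from truncating.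
factorial-pred : ∀ x hs → All (0 <_) hs → factorial x (map pred hs) ≡ factorial (x ℤ.- 1ℤ) hs
factorial-pred x []           []       = refl
factorial-pred x (suc h ∷ hs) (_ ∷ 0<) = cong₂ ℤ._*_ (shift x (+ h)) (factorial-pred (x ℤ.- 1ℤ) hs 0<)
  where
  shift : ∀ x h → x ℤ.+ h ≡ (x ℤ.- 1ℤ) ℤ.+ (1ℤ ℤ.+ h)
  shift = ℤ-Solver.solve-∀

pred-increasing : ∀ {hs} → AllPairs _≤_ hs → AllPairs _≤_ (map pred hs)
pred-increasing = AllPairs.map⁺ ∘ AllPairs.map pred-mono-≤

-- The factorization theorem of Goldman, Joichi and White.
falling-rooks : ∀ N hs → length hs ≡ N → AllPairs _≤_ hs → ∀ x →
                falling (λ k → rooks k hs) N x ≡ factorial x hs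
falling-rooks zero    []       l [] x = refl
falling-rooks (suc N) (h ∷ hs) l (h≤ ∷ hs↗) x = begin
  falling (λ k → rooks k (h ∷ hs)) (suc N) x
    ≡⟨ falling-∷ h (λ k → rooks k (map pred hs)) (λ k → rooks k hs) (λ k → rooks k (h ∷ hs))
         refl (λ _ → refl) N x ⟩
  + h ℤ.* F ℤ.+ (x ℤ.* falling (λ k → rooks k hs) N (x ℤ.- 1ℤ) ℤ.+ + rooks (suc N) hs)
    -- The `N` columns of `hs` have no room for `N + 1` rooks, so the last coefficient is 0.
    ≡⟨ cong (λ t → + h ℤ.* F ℤ.+ t)
         (cong₂ (λ p q → x ℤ.* p ℤ.+ + q) (falling-rooks N hs l′ hs↗ (x ℤ.- 1ℤ))
                (rooks-vanish (suc N) hs (s≤s (≤-reflexive l′)))) ⟩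
  + h ℤ.* F ℤ.+ (x ℤ.* P ℤ.+ 0ℤ)
    ≡⟨ cong (ℤ._+ (x ℤ.* P ℤ.+ 0ℤ)) (rookInFirst h h≤) ⟩
  + h ℤ.* P ℤ.+ (x ℤ.* P ℤ.+ 0ℤ)
    ≡⟨ collect (+ h) x P ⟩
  (x ℤ.+ + h) ℤ.* P ∎
  where
  open ≡-Reasoning
  l′ : length hs ≡ N
  l′ = suc-injective l
  F P : ℤ
  F = falling (λ k → rooks k (map pred hs)) N x
  P = factorial (x ℤ.- 1ℤ) hs
  collect : ∀ h x p → h ℤ.* p ℤ.+ (x ℤ.* p ℤ.+ 0ℤ) ≡ (x ℤ.+ h) ℤ.* p
  collect = ℤ-Solver.solve-∀
  -- For `h` = 0 both products vanish. Otherwise all later heights are positive too, and lowering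
  -- them turns into the shift from `x` to `x − 1`.
  rookInFirst : ∀ h → All (h ≤_) hs → + h ℤ.* F ≡ + h ℤ.* P
  rookInFirst zero    _  = refl
  rookInFirst (suc h) h< = cong (+ suc h ℤ.*_)
    (trans (falling-rooks N (map pred hs) (trans (length-map pred hs) l′) (pred-increasing hs↗) x)
           (factorial-pred x hs (All.map (<-≤-trans z<s) h<)))

-- Padding and the number of cells

rooks-0∷ : ∀ k hs → rooks k (0 ∷ hs) ≡ rooks k hs
rooks-0∷ zero    hs = refl
rooks-0∷ (suc k) hs = refl

rooks-pad : ∀ k m hs → rooks k (pad m hs) ≡ rooks k hs
rooks-pad k zero    hs = refl
rooks-pad k (suc m) hs = trans (rooks-0∷ k (pad m hs)) (rooks-pad k m hs)

rooks-1 : ∀ hs → rooks 1 hs ≡ sum hs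
rooks-1 []       = refl
rooks-1 (h ∷ hs) = cong₂ _+_ (*-identityʳ h) (rooks-1 hs)

-- The dented boards

up : ℕ → (n : ℕ) → Vec ℕ n
up s zero    = []
up s (suc n) = s ∷ up (suc s) n

-- The heights s+1, s+2, …, s+n with the one at position m lowered by 1.
dent : ∀ {n} → ℕ → Fin n → Vec ℕ n
dent {suc n} s zero    = s ∷ up (2 + s) n
dent {suc n} s (suc m) = suc s ∷ dent (suc s) m

-- Numbering columns from 0, column `m + 1` has height `m` and every other column has its index as
-- height. Column 0 cannot be lowered, which leaves `n` choices among `n + 1` columns.
dented : ∀ {n} → Fin n → Vec ℕ (suc n)
dented m = 0 ∷ dent 0 m

∷-up-increasing : ∀ {a} s n → a ≤ s → Increasing (a ∷ toList (up s n))
∷-up-increasing s zero    a≤s = [-]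
∷-up-increasing s (suc n) a≤s = a≤s ∷ ∷-up-increasing (suc s) n (n≤1+n s)

∷-dent-increasing : ∀ {n a} s (m : Fin n) → a ≤ s → Increasing (a ∷ toList (dent s m))
∷-dent-increasing {suc n} s zero    a≤s = a≤s ∷ ∷-up-increasing (2 + s) n (m≤n+m s 2)
∷-dent-increasing {suc n} s (suc m) a≤s = m≤n⇒m≤1+n a≤s ∷ ∷-dent-increasing (suc s) m ≤-refl

dentedBoard : ∀ {n} → Fin n → Board
dentedBoard m = board (toList (dented m)) (∷-dent-increasing 0 m z≤n)

lookup-up : ∀ s n l → lookup (up s n) l ≡ s + toℕ l
lookup-up s (suc n) zero    = sym (+-identityʳ s)
lookup-up s (suc n) (suc l) = trans (lookup-up (suc s) n l) (sym (+-suc s (toℕ l)))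

lookup-dent : ∀ {n} s (m : Fin n) → lookup (dent s m) m ≡ s + toℕ m
lookup-dent {suc n} s zero    = sym (+-identityʳ s)
lookup-dent {suc n} s (suc m) = trans (lookup-dent (suc s) m) (sym (+-suc s (toℕ m)))

lookup-dent-≢ : ∀ {n} s (m l : Fin n) → l ≢ m → lookup (dent s m) l ≡ suc (s + toℕ l)
lookup-dent-≢ {suc n} s zero    zero    l≢m = contradiction refl l≢m
lookup-dent-≢ {suc n} s zero    (suc l) l≢m = trans (lookup-up (2 + s) n l) (cong suc (sym (+-suc s (toℕ l))))
lookup-dent-≢ {suc n} s (suc m) zero    l≢m = cong suc (sym (+-identityʳ s))
lookup-dent-≢ {suc n} s (suc m) (suc l) l≢m =
  trans (lookup-dent-≢ (suc s) m l (l≢m ∘ cong suc)) (cong suc (sym (+-suc s (toℕ l))))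

dented-differ : ∀ {n} {m m′ : Fin n} → m ≢ m′ → DifferInTwoColumns (dented m) (dented m′)
dented-differ {n} {m} {m′} m≢m′ =
  -- In column `m′ + 1` only the second board is lowered, in column `m + 1` only the first; so the
  -- first has the extra cell in column `m′ + 1`.
  differ (suc m′) (suc m) 1 z<s (step m m′ (m≢m′ ∘ sym)) (sym (step m′ m m≢m′)) other
  where
  step : ∀ (m l : Fin n) → l ≢ m → lookup (dent 0 m) l ≡ lookup (dent 0 l) l + 1
  step m l l≢m = trans (lookup-dent-≢ 0 m l l≢m)
    (trans (cong suc (sym (lookup-dent 0 l))) (+-comm 1 (lookup (dent 0 l) l)))
  other : ∀ l → l ≢ suc m′ → l ≢ suc m → lookup (dented m) l ≡ lookup (dented m′) l
  other zero    _    _   = refl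
  other (suc l) l≢m′ l≢m =
    trans (lookup-dent-≢ 0 m l (l≢m ∘ cong suc)) (sym (lookup-dent-≢ 0 m′ l (l≢m′ ∘ cong suc)))

dented-adjacent : ∀ {n} {m m′ : Fin n} → m ≢ m′ → Adjacent (dentedBoard m) (dentedBoard m′)
dented-adjacent {n} {m} {m′} m≢m′ =
  suc n , dented m , dented m′ , (0 , refl) , (0 , refl) , dented-differ m≢m′

-- Different indices would make the two boards adjacent, and equal boards are never adjacent.
dentedBoard-injective : ∀ {n} {m m′ : Fin n} → dentedBoard m ≈ᴮ dentedBoard m′ → m ≡ m′
dentedBoard-injective {m = m} {m′} e = decidable-stable (m Fin.≟ m′)
  (adjacent-irrefl {dentedBoard m} {dentedBoard m′} e ∘ dented-adjacent)

applyUpTo-dent : ∀ s n f → (∀ i → f i ≡ suc s + i) → applyUpTo f n ++ [ s + n ] ≡ toList (dent s (fromℕ n))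
applyUpTo-dent s zero    f f≗ = cong [_] (+-identityʳ s)
applyUpTo-dent s (suc n) f f≗ = cong₂ _∷_ (trans (f≗ 0) (+-identityʳ (suc s)))
  (trans (cong (λ t → applyUpTo (f ∘ suc) n ++ [ t ]) (+-suc s n))
         (applyUpTo-dent (suc s) n (f ∘ suc) (λ i → trans (f≗ (suc i)) (+-suc (suc s) i))))

-- The repeated last height `n` stands in the column of index `n + 1`, so the dent is at the last
-- position.
staircase-dented : ∀ n → heights (staircase (suc n)) ≡ toList (dented (fromℕ n))
staircase-dented n = cong (0 ∷_) (applyUpTo-dent 0 n suc (λ _ → refl))

-- The polynomial of a dented board

factorial-up : ∀ x s n → factorial (x ℤ.- + s) (toList (up s n)) ≡ x ℤ.^ n
factorial-up x s zero    = refl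
factorial-up x s (suc n) = cong₂ ℤ._*_ (cancel x (+ s))
  (trans (cong (λ y → factorial y (toList (up (suc s) n))) (shift x (+ s))) (factorial-up x (suc s) n))
  where
  cancel : ∀ x s → x ℤ.- s ℤ.+ s ≡ x
  cancel = ℤ-Solver.solve-∀
  shift : ∀ x s → x ℤ.- s ℤ.- 1ℤ ≡ x ℤ.- (1ℤ ℤ.+ s)
  shift = ℤ-Solver.solve-∀

-- The offset turns each factor into `x`, except for `x − 1` at the dent. The additional `x` on the
-- left, which column 0 supplies in `dented`, avoids the exponent `n − 1`.
factorial-dent : ∀ {n} x s (m : Fin n) →
                 x ℤ.* factorial (x ℤ.- + suc s) (toList (dent s m)) ≡ x ℤ.^ n ℤ.* (x ℤ.- 1ℤ)
factorial-dent {suc n} x s zero = begin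
  x ℤ.* ((x ℤ.- + suc s ℤ.+ + s) ℤ.* factorial (x ℤ.- + suc s ℤ.- 1ℤ) (toList (up (2 + s) n)))
    ≡⟨ cong (x ℤ.*_) (cong₂ ℤ._*_ (lower x (+ s))
         (trans (cong (λ y → factorial y (toList (up (2 + s) n))) (shift x (+ s))) (factorial-up x (2 + s) n))) ⟩
  x ℤ.* ((x ℤ.- 1ℤ) ℤ.* x ℤ.^ n)
    ≡⟨ swap x (x ℤ.- 1ℤ) (x ℤ.^ n) ⟩
  x ℤ.* x ℤ.^ n ℤ.* (x ℤ.- 1ℤ) ∎
  where
  open ≡-Reasoning
  lower : ∀ x s → x ℤ.- (1ℤ ℤ.+ s) ℤ.+ s ≡ x ℤ.- 1ℤ
  lower = ℤ-Solver.solve-∀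
  shift : ∀ x s → x ℤ.- (1ℤ ℤ.+ s) ℤ.- 1ℤ ≡ x ℤ.- (1ℤ ℤ.+ (1ℤ ℤ.+ s))
  shift = ℤ-Solver.solve-∀
  swap : ∀ x y p → x ℤ.* (y ℤ.* p) ≡ x ℤ.* p ℤ.* y
  swap = ℤ-Solver.solve-∀
factorial-dent {suc n} x s (suc m) = begin
  x ℤ.* ((x ℤ.- + suc s ℤ.+ + suc s) ℤ.* factorial (x ℤ.- + suc s ℤ.- 1ℤ) (toList (dent (suc s) m)))
    ≡⟨ cong (x ℤ.*_) (cong₂ ℤ._*_ (cancel x (+ suc s))
         (cong (λ y → factorial y (toList (dent (suc s) m))) (shift x (+ suc s)))) ⟩
  x ℤ.* (x ℤ.* factorial (x ℤ.- + suc (suc s)) (toList (dent (suc s) m)))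
    ≡⟨ cong (x ℤ.*_) (factorial-dent x (suc s) m) ⟩
  x ℤ.* (x ℤ.^ n ℤ.* (x ℤ.- 1ℤ))
    ≡⟨ ℤ.*-assoc x (x ℤ.^ n) (x ℤ.- 1ℤ) ⟨
  x ℤ.* x ℤ.^ n ℤ.* (x ℤ.- 1ℤ) ∎
  where
  open ≡-Reasoning
  cancel : ∀ x s → x ℤ.- s ℤ.+ s ≡ x
  cancel = ℤ-Solver.solve-∀
  shift : ∀ x s → x ℤ.- s ℤ.- 1ℤ ≡ x ℤ.- (1ℤ ℤ.+ s)
  shift = ℤ-Solver.solve-∀

factorial-dented : ∀ {n} x (m : Fin n) → factorial x (toList (dented m)) ≡ x ℤ.^ n ℤ.* (x ℤ.- 1ℤ)
factorial-dented x m =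
  trans (cong (ℤ._* factorial (x ℤ.- 1ℤ) (toList (dent 0 m))) (ℤ.+-identityʳ x)) (factorial-dent x 0 m)

-- The common polynomial fixes the rook numbers up to the number of columns; beyond that they are 0.
rooks-dented : ∀ {n} (m m′ : Fin n) k → rooks k (toList (dented m)) ≡ rooks k (toList (dented m′))
rooks-dented {n} m m′ k with ≤-<-connex k (suc n)
... | inj₁ k≤ = falling-injective (λ k → rooks k (toList (dented m))) (λ k → rooks k (toList (dented m′))) (suc n)
    (λ x → trans (eval m (+ x)) (sym (eval m′ (+ x)))) k k≤
  where
  eval : ∀ m x → falling (λ k → rooks k (toList (dented m))) (suc n) x ≡ x ℤ.^ n ℤ.* (x ℤ.- 1ℤ)
  eval m x = trans (falling-rooks (suc n) (toList (dented m)) (length-toList (dented m))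
                     (Sorted⇒AllPairs ≤-totalOrder (increasing (dentedBoard m))) x)
                   (factorial-dented x m)
... | inj₂ >k = trans (vanish m) (sym (vanish m′))
  where
  vanish : ∀ m → rooks k (toList (dented m)) ≡ 0
  vanish m = rooks-vanish k (toList (dented m)) (subst (_< k) (sym (length-toList (dented m))) >k)

-- Boards whose only roots are 0 and 1

data Near : ℕ → List ℕ → Set where
  []   : ∀ {s} → Near s []
  full : ∀ {s hs} → Near (suc s) hs → Near s (s ∷ hs)
  low  : ∀ {s hs} → Near (2 + s) hs → Near (suc s) (s ∷ hs)

-- The column of index s and height h contributes the root s − h.
near : ∀ s hs → (∀ x → factorial (x ℤ.- + s) hs ≡ 0ℤ → x ≡ 0ℤ ⊎ x ≡ 1ℤ) → Near s hs
near s []       roots = []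
near s (h ∷ hs) roots = first (roots (+ s ℤ.- + h)
  (cong (ℤ._* factorial (+ s ℤ.- + h ℤ.- + s ℤ.- 1ℤ) hs) (cancel (+ s) (+ h))))
  where
  cancel : ∀ s h → s ℤ.- h ℤ.- s ℤ.+ h ≡ 0ℤ
  cancel = ℤ-Solver.solve-∀
  shift : ∀ x s → x ℤ.- (1ℤ ℤ.+ s) ≡ x ℤ.- s ℤ.- 1ℤ
  shift = ℤ-Solver.solve-∀
  -- A root of the product over the later columns is a root of the whole product, once the shift by
  -- 1 is absorbed into the start index.
  rest : Near (suc s) hs
  rest = near (suc s) hs λ x e → roots x
    (trans (cong ((x ℤ.- + s ℤ.+ + h) ℤ.*_) (trans (cong (λ y → factorial y hs) (sym (shift x (+ s)))) e))
           (ℤ.*-zeroʳ (x ℤ.- + s ℤ.+ + h)))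
  recover : ∀ s h → s ≡ (s ℤ.- h) ℤ.+ h
  recover = ℤ-Solver.solve-∀
  first : + s ℤ.- + h ≡ 0ℤ ⊎ + s ℤ.- + h ≡ 1ℤ → Near s (h ∷ hs)
  first (inj₁ e) with refl ← ℤ.+-injective (ℤ.i-j≡0⇒i≡j (+ s) (+ h) e) = full rest
  first (inj₂ e) with refl ← ℤ.+-injective (trans (recover (+ s) (+ h)) (cong (ℤ._+ + h) e)) = low rest

sum-near : ∀ {s hs} → Near s hs → sum hs ≤ sum (toList (up s (length hs)))
sum-near []                     = z≤n
sum-near {s} (full near)        = +-monoʳ-≤ s (sum-near near)
sum-near (low {s} near)         = +-mono-≤ (n≤1+n s) (sum-near near)

-- Every `low` costs a cell, so a sum that attains the bound of `sum-near` allows none.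
near-full : ∀ {s hs} → Near s hs → sum hs ≡ sum (toList (up s (length hs))) →
            hs ≡ toList (up s (length hs))
near-full []              e = refl
near-full {s} (full near) e = cong (s ∷_) (near-full near (+-cancelˡ-≡ s _ _ e))
near-full (low {s} near)  e = contradiction e (<⇒≢ (s≤s (+-monoʳ-≤ s (sum-near near))))

-- One missing cell means exactly one `low`: a `full` column passes the deficit on, and after the
-- first `low` no deficit remains, so `near-full` settles the rest.
near-dent : ∀ {s hs} → Near (suc s) hs → suc (sum hs) ≡ sum (toList (up (suc s) (length hs))) →
            ∃ λ (m : Fin (length hs)) → hs ≡ toList (dent s m)
near-dent {s} (full {hs = hs} near) e
  with m , eq ← near-dent near (+-cancelˡ-≡ (suc s) _ _ (trans (+-suc (suc s) (sum hs)) e)) =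
  suc m , cong (suc s ∷_) eq
near-dent (low {s} near) e = zero , cong (s ∷_) (near-full near (+-cancelˡ-≡ (suc s) _ _ e))

sum-dent : ∀ {n} s (m : Fin n) → suc (sum (toList (dent s m))) ≡ sum (toList (up (suc s) n))
sum-dent {suc n} s zero    = refl
sum-dent {suc n} s (suc m) = trans (sym (+-suc (suc s) _)) (cong (_+_ (suc s)) (sum-dent (suc s) m))

-- Equivalent boards are padded dented boards

pad-increasing : ∀ m {hs} → AllPairs _≤_ hs → AllPairs _≤_ (pad m hs)
pad-increasing zero    hs↗ = hs↗
pad-increasing (suc m) hs↗ = All.universal (λ _ → z≤n) _ ∷ pad-increasing m hs↗

-- The numbers of columns must agree, because padding preserves `rooks` but changes `factorial`.
factorial-unique : ∀ {hs hs′} → length hs ≡ length hs′ → AllPairs _≤_ hs → AllPairs _≤_ hs′ →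
                   (∀ k → rooks k hs ≡ rooks k hs′) → ∀ x → factorial x hs ≡ factorial x hs′
factorial-unique {hs} {hs′} l hs↗ hs′↗ eq x = begin
  factorial x hs                              ≡⟨ falling-rooks (length hs′) hs l hs↗ x ⟨
  falling (λ k → rooks k hs) (length hs′) x   ≡⟨ falling-cong eq (length hs′) x ⟩
  falling (λ k → rooks k hs′) (length hs′) x  ≡⟨ falling-rooks (length hs′) hs′ refl hs′↗ x ⟩
  factorial x hs′                             ∎
  where open ≡-Reasoning

dented-roots : ∀ {n} (m : Fin n) x → factorial x (toList (dented m)) ≡ 0ℤ → x ≡ 0ℤ ⊎ x ≡ 1ℤ
dented-roots {n} m x e with ℤ.i*j≡0⇒i≡0∨j≡0 (x ℤ.^ n) (trans (sym (factorial-dented x m)) e)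
... | inj₁ xⁿ≡0  = inj₁ (ℤ.i^n≡0⇒i≡0 x n xⁿ≡0)
... | inj₂ x-1≡0 = inj₂ (ℤ.i-j≡0⇒i≡j x 1ℤ x-1≡0)

-- Each column of padding contributes the root 0 and raises the roots of the remaining columns by 1,
-- so none becomes negative.
pad-dented-roots : ∀ {n} p (m : Fin n) x →
                   factorial x (pad p (toList (dented m))) ≡ 0ℤ → ∃ λ a → x ≡ + a
pad-dented-roots zero m x e with dented-roots m x e
... | inj₁ x≡0 = 0 , x≡0
... | inj₂ x≡1 = 1 , x≡1
pad-dented-roots (suc p) m x e with ℤ.i*j≡0⇒i≡0∨j≡0 (x ℤ.+ 0ℤ) e
... | inj₁ x+0≡0 = 0 , trans (sym (ℤ.+-identityʳ x)) x+0≡0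
... | inj₂ e′ with a , x-1≡a ← pad-dented-roots p m (x ℤ.- 1ℤ) e′ =
  suc a , trans (recover x) (cong (ℤ._+_ 1ℤ) x-1≡a)
  where
  recover : ∀ x → x ≡ 1ℤ ℤ.+ (x ℤ.- 1ℤ)
  recover = ℤ-Solver.solve-∀

-- The first height h yields the root −h, which must be nonnegative.
head≡0 : ∀ {n} p (m : Fin n) {h hs} → length (h ∷ hs) ≡ p + suc n → AllPairs _≤_ (h ∷ hs) →
         (∀ k → rooks k (h ∷ hs) ≡ rooks k (toList (dented m))) → h ≡ 0
head≡0 p m {h} {hs} l hs↗ eq with pad-dented-roots p m (ℤ.- + h) (begin
    factorial (ℤ.- + h) (pad p (toList (dented m)))
      ≡⟨ factorial-unique
           (trans l (trans (cong (_+_ p) (sym (length-toList (dented m))))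
                           (sym (length-pad p (toList (dented m))))))
           hs↗ (pad-increasing p (Sorted⇒AllPairs ≤-totalOrder (increasing (dentedBoard m))))
           (λ k → trans (eq k) (sym (rooks-pad k p (toList (dented m))))) (ℤ.- + h) ⟨
    (ℤ.- + h ℤ.+ + h) ℤ.* factorial (ℤ.- + h ℤ.- 1ℤ) hs
      ≡⟨ cong (ℤ._* factorial (ℤ.- + h ℤ.- 1ℤ) hs) (ℤ.+-inverseˡ (+ h)) ⟩
    0ℤ ∎)
  where open ≡-Reasoning
head≡0 p m {zero}  l hs↗ eq | _ = refl
head≡0 p m {suc h} l hs↗ eq | a , ()

rooks⇒sum : ∀ hs hs′ → (∀ k → rooks k hs ≡ rooks k hs′) → sum hs ≡ sum hs′
rooks⇒sum hs hs′ eq = trans (sym (rooks-1 hs)) (trans (eq 1) (rooks-1 hs′))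

rooks⇒near : ∀ {n} (m : Fin n) {hs} → length hs ≡ suc n → AllPairs _≤_ hs →
             (∀ k → rooks k hs ≡ rooks k (toList (dented m))) → Near 0 hs
rooks⇒near m {hs} l hs↗ eq = near 0 hs λ x e → dented-roots m x (begin
  factorial x (toList (dented m))
    ≡⟨ factorial-unique (trans l (sym (length-toList (dented m)))) hs↗
         (Sorted⇒AllPairs ≤-totalOrder (increasing (dentedBoard m))) eq x ⟨
  factorial x hs           ≡⟨ cong (λ y → factorial y hs) (ℤ.+-identityʳ x) ⟨
  factorial (x ℤ.+ 0ℤ) hs  ≡⟨ e ⟩
  0ℤ                       ∎)
  where open ≡-Reasoning

-- The `p` surplus columns are stripped one at a time, each having height 0 by `head≡0`. With
-- `n + 1` columns left, the roots and the number of cells determine the board up to the place of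
-- the dent.
rooks⇒dented : ∀ {n} p (m : Fin n) hs → length hs ≡ p + suc n → AllPairs _≤_ hs →
               (∀ k → rooks k hs ≡ rooks k (toList (dented m))) →
               ∃ λ (m′ : Fin n) → hs ≡ pad p (toList (dented m′))
rooks⇒dented (suc p) m (h ∷ hs) l hs↗@(_ ∷ hs↗′) eq with refl ← head≡0 (suc p) m l hs↗ eq
  with m′ , hs≡ ← rooks⇒dented p m hs (suc-injective l) hs↗′ (λ k → trans (sym (rooks-0∷ k hs)) (eq k)) =
  m′ , cong (0 ∷_) hs≡
rooks⇒dented zero m (h ∷ hs) l hs↗ eq with refl ← head≡0 0 m l hs↗ eq | refl ← suc-injective l
  -- At index 0 only `full` is possible. The count of cells then shows that exactly one is missing
  -- from the heights 1, ..., `n`.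
  with full near ← rooks⇒near m l hs↗ eq
  with m′ , hs≡ ← near-dent near
         (trans (cong suc (rooks⇒sum (0 ∷ hs) (toList (dented m)) eq)) (sum-dent 0 m)) =
  m′ , cong (0 ∷_) hs≡

-- The isomorphism with the complete graph

staircase-equivalent : ∀ {n} (m : Fin (suc n)) → RookEquivalent (staircase (suc n)) (dentedBoard m)
staircase-equivalent {n} m k = begin
  r k (staircase (suc n))                ≡⟨ r≡rooks k (staircase (suc n)) ⟩
  rooks k (heights (staircase (suc n)))  ≡⟨ cong (rooks k) (staircase-dented n) ⟩
  rooks k (toList (dented (fromℕ n)))    ≡⟨ rooks-dented (fromℕ n) m k ⟩
  rooks k (toList (dented m))            ≡⟨ r≡rooks k (dentedBoard m) ⟨
  r k (dentedBoard m)                    ∎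
  where open ≡-Reasoning

equivalent⇒dented : ∀ {n} B → RookEquivalent (staircase (suc n)) B →
                    ∃ λ (m : Fin (suc n)) → B ≈ᴮ dentedBoard m
equivalent⇒dented {n} B eq =
  -- A representative of the board may have fewer than `n + 2` columns. Padding it by `n + 2`
  -- guarantees enough, and its original length becomes the surplus. The index `zero` merely selects
  -- a reference board in the class.
  let m , hs≡ = rooks⇒dented (length (heights B)) zero (pad (2 + n) (heights B))
        (trans (length-pad (2 + n) (heights B)) (+-comm (2 + n) (length (heights B))))
        (pad-increasing (2 + n) (Sorted⇒AllPairs ≤-totalOrder (increasing B)))
        same
  in m , 2 + n , length (heights B) , hs≡
  where
  open ≡-Reasoning
  same : ∀ k → rooks k (pad (2 + n) (heights B)) ≡ rooks k (toList (dented {suc n} zero))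
  same k = begin
    rooks k (pad (2 + n) (heights B))      ≡⟨ rooks-pad k (2 + n) (heights B) ⟩
    rooks k (heights B)                    ≡⟨ r≡rooks k B ⟨
    r k B                                  ≡⟨ eq k ⟨
    r k (staircase (suc n))                ≡⟨ staircase-equivalent {n} zero k ⟩
    r k (dentedBoard {suc n} zero)         ≡⟨ r≡rooks k (dentedBoard {suc n} zero) ⟩
    rooks k (toList (dented {suc n} zero)) ∎

≈-resp-Adjacent : ∀ {A B C D} → A ≈ᴮ B → C ≈ᴮ D → Adjacent B D → Adjacent A C
≈-resp-Adjacent {A} {B} {C} {D} A≈B C≈D adj =
  adjacent-respʳ {A} {D} {C} (Setoid.sym boardSetoid {C} {D} C≈D)
    (adjacent-sym {D} {A} (adjacent-respʳ {D} {B} {A} (Setoid.sym boardSetoid {A} {B} A≈B)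
      (adjacent-sym {B} {D} adj)))

theorem11 : (n : ℕ) → 0 < n → G (staircase n) ≅ K n
theorem11 (suc n) _ = record
  { bijection = record
    { to        = to
    ; from      = λ m → dentedBoard m , staircase-equivalent m
    ; to-cong   = λ {x} {y} → to-cong x y
    ; from-cong = λ { {m} refl → Setoid.refl boardSetoid {dentedBoard m} }
    ; inverse   = (λ {m} {x} x≈m → dentedBoard-injective (begin
                    dentedBoard (to x) ≈⟨ ≈to x ⟨
                    proj₁ x            ≈⟨ x≈m ⟩
                    dentedBoard m      ∎))
                , (λ { {x} refl → Setoid.sym boardSetoid {proj₁ x} {dentedBoard (to x)} (≈to x) })
    }
  ; edges = λ x y → mk⇔
      -- Equal images would mean equal boards, which cannot be adjacent.
      (λ adj to≡ → adjacent-irrefl {proj₁ x} {proj₁ y} (to-injective x y to≡) adj)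
      -- Adjacency can be tested on the dented representatives, where distinct indices suffice.
      (λ to≢ → ≈-resp-Adjacent {proj₁ x} {dentedBoard (to x)} {proj₁ y} {dentedBoard (to y)}
                 (≈to x) (≈to y) (dented-adjacent to≢))
  }
  where
  open ≈-Reasoning boardSetoid
  Vertex : Set
  Vertex = Graph.Vertex (G (staircase (suc n)))
  to : Vertex → Fin (suc n)
  to (B , eq) = proj₁ (equivalent⇒dented B eq)
  ≈to : ∀ x → proj₁ x ≈ᴮ dentedBoard (to x)
  ≈to (B , eq) = proj₂ (equivalent⇒dented B eq)
  to-cong : ∀ x y → proj₁ x ≈ᴮ proj₁ y → to x ≡ to y
  to-cong x y x≈y = dentedBoard-injective (begin
    dentedBoard (to x) ≈⟨ ≈to x ⟨
    proj₁ x            ≈⟨ x≈y ⟩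
    proj₁ y            ≈⟨ ≈to y ⟩
    dentedBoard (to y) ∎)
  to-injective : ∀ x y → to x ≡ to y → proj₁ x ≈ᴮ proj₁ y
  to-injective x y to≡ = begin
    proj₁ x            ≈⟨ ≈to x ⟩
    dentedBoard (to x) ≡⟨ cong dentedBoard to≡ ⟩
    dentedBoard (to y) ≈⟨ ≈to y ⟨
    proj₁ y            ∎
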